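{- Let $\varepsilon\in\{1,-1\}$ and let $a$ be an integer with $|a|\le 2$. If $(x_1,x_2,x_3)\in\Gamma_a$ satisfies $|x_1|<|x_2|<|x_3|$, then $(y_1,y_2,x_3)^T:=B^{\varepsilon}(x_1,x_2,x_3)^T$ lies in $\Gamma_a$, satisfies $|y_1|>|y_2|>|x_3|$, and $\varepsilon y_1y_2>0$.
   Context: For an integer $a$, $\Gamma_a$ is the set of $(x_1,x_2,x_3)\in\mathbb{Z}^3$ with $x_1^2-2x_2^2+x_3^2=a$. $B=\begin{pmatrix}3&4&0\\2&3&0\\0&0&1\end{pmatrix}$, acting on column vectors (note $B^{\varepsilon}$ fixes the third coordinate). -}

module Defs where

open import Data.Integer using (ℤ; +_; -_; _+_; _*_; _-_)
open import Data.Product using (_×_; _,_)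
open import Data.Sign using (Sign)
open import Relation.Binary.PropositionalEquality using (_≡_)

-- integer column vectors of length 3 and 3×3 integer matrices (rows)
Vec3 : Set
Vec3 = ℤ × ℤ × ℤ

Mat3 : Set
Mat3 = Vec3 × Vec3 × Vec3

dot : Vec3 → Vec3 → ℤ
dot (a , b , c) (x , y , z) = a * x + b * y + c * z

-- matrix acting on a column vector
_·_ : Mat3 → Vec3 → Vec3
(r₁ , r₂ , r₃) · v = dot r₁ v , dot r₂ v , dot r₃ v

-- Γ_a = { x ∈ ℤ³ | x₁² - 2 x₂² + x₃² = a }
Γ : ℤ → Vec3 → Set
Γ a (x₁ , x₂ , x₃) = x₁ * x₁ - (+ 2) * (x₂ * x₂) + x₃ * x₃ ≡ a

-- B = [[3,4,0],[2,3,0],[0,0,1]]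
B : Mat3
B = ((+ 3) , (+ 4) , (+ 0)) , ((+ 2) , (+ 3) , (+ 0)) , ((+ 0) , (+ 0) , (+ 1))

-- B⁻¹ = [[3,-4,0],[-2,3,0],[0,0,1]]  (det B = 1)
B⁻¹ : Mat3
B⁻¹ = ((+ 3) , (- (+ 4)) , (+ 0)) , ((- (+ 2)) , (+ 3) , (+ 0)) , ((+ 0) , (+ 0) , (+ 1))

-- ε ∈ {1, -1} represented as a Sign; B^ε
B^ : Sign → Mat3
B^ Sign.+ = B
B^ Sign.- = B⁻¹

-- the integer ε
⟦_⟧ : Sign → ℤ
⟦ Sign.+ ⟧ = + 1
⟦ Sign.- ⟧ = - (+ 1)

module Submission where

open import Defs
open import Data.Integer using (ℤ; +_; -_; _*_; _≤_; _<_; _>_; ∣_∣)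
open import Data.Nat using () renaming (_<_ to _<ℕ_; _>_ to _>ℕ_; _≤_ to _≤ℕ_)
open import Data.Product using (_×_; _,_)
open import Data.Sign using (Sign)
open import Relation.Binary.PropositionalEquality using (_≡_)

open import Data.Integer using (_+_; _-_; _⊖_; -[1+_]; +≤+; +<+; -≤+)
import Data.Integer.Properties as ℤP
open import Data.Integer.Tactic.RingSolver using (solve-∀)
open import Data.Nat as ℕ using (ℕ; suc; s≤s; z≤n)
import Data.Nat.Properties as ℕP
import Data.Nat.Tactic.RingSolver as ℕSolver
open import Data.Product using (∃-syntax; proj₁; proj₂)
open import Relation.Binary.PropositionalEquality
  using (refl; sym; trans; cong; cong₂; subst; subst₂; module ≡-Reasoning)
open import Relation.Nullary using (yes; no; contradiction)

-- Proof of Lemma 5.3.  Write (u, v) = (x₁, x₂) and c = ∣x₃∣.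
-- Membership of (y₁, y₂, x₃) in Γ_a holds because B and B⁻¹ preserve the
-- quadratic form x₁² - 2x₂² + x₃².  For the inequalities only two facts about
-- the input are needed, ∣u∣ < ∣v∣ and c² + u² ≤ 2 + 2v² (from ∣a∣ ≤ 2).  Call such (u, v) admissible, and call
-- (y₁, y₂) decreasing when ∣y₁∣ > ∣y₂∣ > c and εy₁y₂ > 0.  Two symmetries
-- reduce everything to ε = 1 and v = V ≥ 0: B(-u, -v) = -B(u, v), and
-- B⁻¹(u, v) = (-p, q) where (p, q) = B(-u, v).  In the reduced case
-- w := u + V is a positive integer and
--     y₁ = w + y₂,   y₂ = 2w + V,   u² + 2wV = w² + V²,
-- so y₁ > y₂ > 0, and y₂² + w² + V² = 5w² + 4wV + 2V² > 2 + 2V² + 2wV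
-- ≥ c² + w² + V², i.e. y₂ > c.

-- Squaring reflects the strict order on ℕ.
square-cancel-< : ∀ m n → m ℕ.* m <ℕ n ℕ.* n → m <ℕ n
square-cancel-< m n m²<n² with m ℕ.<? n
... | yes m<n = m<n
... | no  m≮n = contradiction (ℕP.*-mono-≤ n≤m n≤m) (ℕP.<⇒≱ m²<n²)
  where
  n≤m : n ≤ℕ m
  n≤m = ℕP.≮⇒≥ m≮n

-- With w = 1 + i, (2w + V)² + w² + V² exceeds 2 + 2V² + 2wV by
-- 5w² + 2wV - 2 = 3 + 10i + 5i² + 2V + 2iV.
gap-identity : ∀ i V →
  (2 ℕ.+ 2 ℕ.* (V ℕ.* V) ℕ.+ 2 ℕ.* ((1 ℕ.+ i) ℕ.* V))
    ℕ.+ (3 ℕ.+ (10 ℕ.* i ℕ.+ 5 ℕ.* (i ℕ.* i) ℕ.+ 2 ℕ.* V ℕ.+ 2 ℕ.* (i ℕ.* V)))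
  ≡ (1 ℕ.+ i ℕ.+ (1 ℕ.+ i) ℕ.+ V) ℕ.* (1 ℕ.+ i ℕ.+ (1 ℕ.+ i) ℕ.+ V)
    ℕ.+ ((1 ℕ.+ i) ℕ.* (1 ℕ.+ i) ℕ.+ V ℕ.* V)
gap-identity = ℕSolver.solve-∀

-- The key estimate: if U is the square of W - V (i.e. U + 2WV = W² + V²),
-- W ≥ 1 and c² + U ≤ 2 + 2V², then c < 2W + V.
below-2W+V : ∀ i V c U → let W = suc i in
  c ℕ.* c ℕ.+ U ≤ℕ 2 ℕ.+ 2 ℕ.* (V ℕ.* V) →
  U ℕ.+ 2 ℕ.* (W ℕ.* V) ≡ W ℕ.* W ℕ.+ V ℕ.* V →
  c <ℕ W ℕ.+ W ℕ.+ V
below-2W+V i V c U bound u²≡ =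
  square-cancel-< c Q (ℕP.+-cancelʳ-< (W ℕ.* W ℕ.+ V ℕ.* V) (c ℕ.* c) (Q ℕ.* Q) chain)
  where
  open ℕP.≤-Reasoning
  W Q : ℕ
  W = suc i
  Q = W ℕ.+ W ℕ.+ V
  chain : c ℕ.* c ℕ.+ (W ℕ.* W ℕ.+ V ℕ.* V) <ℕ Q ℕ.* Q ℕ.+ (W ℕ.* W ℕ.+ V ℕ.* V)
  chain = begin-strict
    c ℕ.* c ℕ.+ (W ℕ.* W ℕ.+ V ℕ.* V)       ≡⟨ cong (c ℕ.* c ℕ.+_) (sym u²≡) ⟩
    c ℕ.* c ℕ.+ (U ℕ.+ 2 ℕ.* (W ℕ.* V))     ≡⟨ sym (ℕP.+-assoc (c ℕ.* c) U _) ⟩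
    c ℕ.* c ℕ.+ U ℕ.+ 2 ℕ.* (W ℕ.* V)       ≤⟨ ℕP.+-monoˡ-≤ (2 ℕ.* (W ℕ.* V)) bound ⟩
    2 ℕ.+ 2 ℕ.* (V ℕ.* V) ℕ.+ 2 ℕ.* (W ℕ.* V) <⟨ ℕP.m<m+n _ (s≤s z≤n) ⟩
    _                                         ≡⟨ gap-identity i V ⟩
    Q ℕ.* Q ℕ.+ (W ℕ.* W ℕ.+ V ℕ.* V)       ∎

-- The square of an integer is the square of its absolute value.
square-abs : ∀ i → i * i ≡ + (∣ i ∣ ℕ.* ∣ i ∣)
square-abs (+ n)    = ℤP.+◃n≡+n (n ℕ.* n)
square-abs -[1+ n ] = refl

-- An integer is at most any bound on its absolute value.
≤-abs-bound : ∀ i n → ∣ i ∣ ≤ℕ n → i ≤ + n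
≤-abs-bound (+ m)    n m≤n = +≤+ m≤n
≤-abs-bound -[1+ m ] n _   = -≤+

-- If ∣u∣ < V then u + V is a positive integer.
sum-positive : ∀ u V → ∣ u ∣ <ℕ V → ∃[ i ] u + + V ≡ + suc i
sum-positive (+ s)    (suc V) _ = s ℕ.+ V , cong +_ (ℕP.+-suc s V)
sum-positive -[1+ s ] V s<V with ℕP.m≤n⇒∃[o]m+o≡n s<V
... | k , refl = k , (begin
  suc (suc (s ℕ.+ k)) ⊖ suc s  ≡⟨ ℤP.[1+m]⊖[1+n]≡m⊖n (suc (s ℕ.+ k)) s ⟩
  suc (s ℕ.+ k) ⊖ s            ≡⟨ cong (_⊖ s) (sym (ℕP.+-suc s k)) ⟩
  s ℕ.+ suc k ⊖ s              ≡⟨ ℤP.⊖-≥ (ℕP.m≤m+n s (suc k)) ⟩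
  + (s ℕ.+ suc k ℕ.∸ s)        ≡⟨ cong +_ (ℕP.m+n∸m≡n s (suc k)) ⟩
  + suc k                       ∎)
  where open ≡-Reasoning

-- Writing u = w - V with w = u + V:  u² + 2wV = w² + V²  (as naturals).
square-of-difference : ∀ u V W → u + + V ≡ + W →
  ∣ u ∣ ℕ.* ∣ u ∣ ℕ.+ 2 ℕ.* (W ℕ.* V) ≡ W ℕ.* W ℕ.+ V ℕ.* V
square-of-difference u V W u+V≡W = ℤP.+-injective (begin
  + (∣ u ∣ ℕ.* ∣ u ∣) + + (2 ℕ.* (W ℕ.* V))
    ≡⟨ cong₂ _+_ (sym (square-abs u)) (trans (ℤP.pos-* 2 (W ℕ.* V)) (cong (+ 2 *_) (ℤP.pos-* W V))) ⟩
  u * u + + 2 * (+ W * + V)                ≡⟨ cong (λ w → u * u + + 2 * (w * + V)) (sym u+V≡W) ⟩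
  u * u + + 2 * ((u + + V) * + V)          ≡⟨ expand u (+ V) ⟩
  (u + + V) * (u + + V) + + V * + V        ≡⟨ cong (λ w → w * w + + V * + V) u+V≡W ⟩
  + W * + W + + V * + V                    ≡⟨ sym (cong₂ _+_ (ℤP.pos-* W W) (ℤP.pos-* V V)) ⟩
  + (W ℕ.* W) + + (V ℕ.* V)                ∎)
  where
  open ≡-Reasoning
  expand : ∀ u v → u * u + + 2 * ((u + v) * v) ≡ (u + v) * (u + v) + v * v
  expand = solve-∀

-- B and B⁻¹ preserve x₁² - 2x₂² + x₃², hence every Γ_a.
Γ-invariant : ∀ ε a x₁ x₂ x₃ → Γ a (x₁ , x₂ , x₃) → Γ a (B^ ε · (x₁ , x₂ , x₃))
Γ-invariant Sign.+ a x₁ x₂ x₃ γ = trans (B-preserves x₁ x₂ x₃) γ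
  where
  B-preserves : ∀ x₁ x₂ x₃ →
    (+ 3 * x₁ + + 4 * x₂ + + 0 * x₃) * (+ 3 * x₁ + + 4 * x₂ + + 0 * x₃)
      - + 2 * ((+ 2 * x₁ + + 3 * x₂ + + 0 * x₃) * (+ 2 * x₁ + + 3 * x₂ + + 0 * x₃))
      + (+ 0 * x₁ + + 0 * x₂ + + 1 * x₃) * (+ 0 * x₁ + + 0 * x₂ + + 1 * x₃)
    ≡ x₁ * x₁ - + 2 * (x₂ * x₂) + x₃ * x₃
  B-preserves = solve-∀
Γ-invariant Sign.- a x₁ x₂ x₃ γ = trans (B⁻¹-preserves x₁ x₂ x₃) γ
  where
  B⁻¹-preserves : ∀ x₁ x₂ x₃ →
    (+ 3 * x₁ + - (+ 4) * x₂ + + 0 * x₃) * (+ 3 * x₁ + - (+ 4) * x₂ + + 0 * x₃)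
      - + 2 * ((- (+ 2) * x₁ + + 3 * x₂ + + 0 * x₃) * (- (+ 2) * x₁ + + 3 * x₂ + + 0 * x₃))
      + (+ 0 * x₁ + + 0 * x₂ + + 1 * x₃) * (+ 0 * x₁ + + 0 * x₂ + + 1 * x₃)
    ≡ x₁ * x₁ - + 2 * (x₂ * x₂) + x₃ * x₃
  B⁻¹-preserves = solve-∀

-- On Γ_a with ∣a∣ ≤ 2:  x₃² + x₁² = a + 2x₂² ≤ 2 + 2x₂².
Γ-bound : ∀ a x₁ x₂ x₃ → ∣ a ∣ ≤ℕ 2 → Γ a (x₁ , x₂ , x₃) →
  ∣ x₃ ∣ ℕ.* ∣ x₃ ∣ ℕ.+ ∣ x₁ ∣ ℕ.* ∣ x₁ ∣ ≤ℕ 2 ℕ.+ 2 ℕ.* (∣ x₂ ∣ ℕ.* ∣ x₂ ∣)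
Γ-bound a x₁ x₂ x₃ ∣a∣≤2 γ = ℤP.drop‿+≤+ (begin
  + (∣ x₃ ∣ ℕ.* ∣ x₃ ∣) + + (∣ x₁ ∣ ℕ.* ∣ x₁ ∣)
    ≡⟨ sym (cong₂ _+_ (square-abs x₃) (square-abs x₁)) ⟩
  x₃ * x₃ + x₁ * x₁                                   ≡⟨ regroup x₁ x₂ x₃ ⟩
  (x₁ * x₁ - + 2 * (x₂ * x₂) + x₃ * x₃) + + 2 * (x₂ * x₂) ≡⟨ cong (_+ + 2 * (x₂ * x₂)) γ ⟩
  a + + 2 * (x₂ * x₂)        ≤⟨ ℤP.+-monoˡ-≤ (+ 2 * (x₂ * x₂)) (≤-abs-bound a 2 ∣a∣≤2) ⟩
  + 2 + + 2 * (x₂ * x₂)      ≡⟨ cong (λ z → + 2 + + 2 * z) (square-abs x₂) ⟩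
  + 2 + + 2 * + (∣ x₂ ∣ ℕ.* ∣ x₂ ∣) ≡⟨ cong (_+_ (+ 2)) (sym (ℤP.pos-* 2 (∣ x₂ ∣ ℕ.* ∣ x₂ ∣))) ⟩
  + (2 ℕ.+ 2 ℕ.* (∣ x₂ ∣ ℕ.* ∣ x₂ ∣)) ∎)
  where
  open ℤP.≤-Reasoning
  regroup : ∀ x₁ x₂ x₃ → x₃ * x₃ + x₁ * x₁ ≡ (x₁ * x₁ - + 2 * (x₂ * x₂) + x₃ * x₃) + + 2 * (x₂ * x₂)
  regroup = solve-∀

-- Hypotheses on the input in terms of s = ∣u∣, t = ∣v∣ and c = ∣x₃∣.
Admissible : ℕ → ℕ → ℕ → Set
Admissible c s t = s <ℕ t × c ℕ.* c ℕ.+ s ℕ.* s ≤ℕ 2 ℕ.+ 2 ℕ.* (t ℕ.* t)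

-- The conclusion of the lemma for an output pair (y₁, y₂).
Decreasing : Sign → ℕ → ℤ → ℤ → Set
Decreasing ε c y₁ y₂ = (∣ y₁ ∣ >ℕ ∣ y₂ ∣ × ∣ y₂ ∣ >ℕ c) × ⟦ ε ⟧ * y₁ * y₂ > + 0

-- Being decreasing depends only on ∣y₁∣, ∣y₂∣ and the sign of εy₁y₂.
decreasing-transfer : ∀ {ε ε′ c} y₁ y₂ z₁ z₂ → ∣ y₁ ∣ ≡ ∣ z₁ ∣ → ∣ y₂ ∣ ≡ ∣ z₂ ∣ →
  ⟦ ε ⟧ * y₁ * y₂ ≡ ⟦ ε′ ⟧ * z₁ * z₂ → Decreasing ε c y₁ y₂ → Decreasing ε′ c z₁ z₂
decreasing-transfer {c = c} _ _ _ _ e₁ e₂ e ((y₂<y₁ , c<y₂) , εy₁y₂>0) =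
  (subst₂ _<ℕ_ e₂ e₁ y₂<y₁ , subst (c <ℕ_) e₂ c<y₂) , subst (+ 0 <_) e εy₁y₂>0

-- Negating both outputs preserves being decreasing.
decreasing-neg : ∀ {ε c} y₁ y₂ → Decreasing ε c y₁ y₂ → Decreasing ε c (- y₁) (- y₂)
decreasing-neg {ε} {c} y₁ y₂ = decreasing-transfer {ε} {ε} {c} y₁ y₂ (- y₁) (- y₂)
  (sym (ℤP.∣-i∣≡∣i∣ y₁)) (sym (ℤP.∣-i∣≡∣i∣ y₂)) (sym (neg-neg ⟦ ε ⟧ y₁ y₂))
  where
  neg-neg : ∀ e a b → e * (- a) * (- b) ≡ e * a * b
  neg-neg = solve-∀

-- Negating the first output turns a decreasing pair for ε = 1 into one for ε = -1.
decreasing-flip : ∀ {c} y₁ y₂ → Decreasing Sign.+ c y₁ y₂ → Decreasing Sign.- c (- y₁) y₂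
decreasing-flip {c} y₁ y₂ =
  decreasing-transfer {Sign.+} {Sign.-} {c} y₁ y₂ (- y₁) y₂ (sym (ℤP.∣-i∣≡∣i∣ y₁)) refl (sym (flip y₁ y₂))
  where
  flip : ∀ a b → - (+ 1) * (- a) * b ≡ + 1 * a * b
  flip = solve-∀

-- A pair (W + Q, Q) of naturals with W > 0 and Q > c is decreasing for ε = 1.
decreasing-pos : ∀ W Q c → 0 <ℕ W → c <ℕ Q → Decreasing Sign.+ c (+ (W ℕ.+ Q)) (+ Q)
decreasing-pos W Q c 0<W c<Q =
  (ℕP.m<n+m Q 0<W , c<Q) , subst (+ 0 <_) (sym product) (+<+ (ℕP.*-mono-< 0<W+Q 0<Q))
  where
  0<Q : 0 <ℕ Q
  0<Q = ℕP.≤-<-trans z≤n c<Q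
  0<W+Q : 0 <ℕ W ℕ.+ Q
  0<W+Q = ℕP.<-≤-trans 0<W (ℕP.m≤m+n W Q)
  product : ⟦ Sign.+ ⟧ * + (W ℕ.+ Q) * + Q ≡ + ((W ℕ.+ Q) ℕ.* Q)
  product = trans (cong (_* + Q) (ℤP.*-identityˡ (+ (W ℕ.+ Q)))) (sym (ℤP.pos-* (W ℕ.+ Q) Q))

-- The first two rows of B, acting on (u, v).
B₁ B₂ : ℤ → ℤ → ℤ
B₁ u v = + 3 * u + + 4 * v
B₂ u v = + 2 * u + + 3 * v

-- B maps admissible pairs with v = V ≥ 0 to decreasing pairs: with w = u + V,
-- B₁ = w + B₂ and B₂ = 2w + V.
B-decreasing⁺ : ∀ u V c → Admissible c ∣ u ∣ V → Decreasing Sign.+ c (B₁ u (+ V)) (B₂ u (+ V))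
B-decreasing⁺ u V c (u<V , bound) with sum-positive u V u<V
... | i , u+V≡W = subst₂ (Decreasing Sign.+ c) (sym B₁≡) (sym B₂≡)
        (decreasing-pos W (W ℕ.+ W ℕ.+ V) c (s≤s z≤n)
          (below-2W+V i V c _ bound (square-of-difference u V W u+V≡W)))
  where
  W : ℕ
  W = suc i
  split₁ : ∀ u v → + 3 * u + + 4 * v ≡ (u + v) + ((u + v) + (u + v) + v)
  split₁ = solve-∀
  split₂ : ∀ u v → + 2 * u + + 3 * v ≡ (u + v) + (u + v) + v
  split₂ = solve-∀
  B₁≡ : B₁ u (+ V) ≡ + (W ℕ.+ (W ℕ.+ W ℕ.+ V))
  B₁≡ = trans (split₁ u (+ V)) (cong (λ w → w + (w + w + + V)) u+V≡W)
  B₂≡ : B₂ u (+ V) ≡ + (W ℕ.+ W ℕ.+ V)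
  B₂≡ = trans (split₂ u (+ V)) (cong (λ w → w + w + + V) u+V≡W)

-- B maps every admissible pair to a decreasing pair; negative v reduces to
-- positive v since B(u, v) = -B(-u, -v).
B-decreasing : ∀ u v c → Admissible c ∣ u ∣ ∣ v ∣ → Decreasing Sign.+ c (B₁ u v) (B₂ u v)
B-decreasing u (+ V) c adm = B-decreasing⁺ u V c adm
B-decreasing u -[1+ n ] c adm =
  subst₂ (Decreasing Sign.+ c) (odd₁ u -[1+ n ]) (odd₂ u -[1+ n ])
    (decreasing-neg {Sign.+} {c} (B₁ (- u) (+ suc n)) (B₂ (- u) (+ suc n))
      (B-decreasing⁺ (- u) (suc n) c (subst (λ s → Admissible c s (suc n)) (sym (ℤP.∣-i∣≡∣i∣ u)) adm)))
  where
  odd₁ : ∀ u v → - (+ 3 * (- u) + + 4 * (- v)) ≡ + 3 * u + + 4 * v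
  odd₁ = solve-∀
  odd₂ : ∀ u v → - (+ 2 * (- u) + + 3 * (- v)) ≡ + 2 * u + + 3 * v
  odd₂ = solve-∀

-- B^ε maps admissible inputs to decreasing outputs.  The rows of B are B₁, B₂,
-- and those of B⁻¹ are -B₁(-u, v), B₂(-u, v), which reduces ε = -1 to ε = 1.
B^-decreasing : ∀ ε x₁ x₂ x₃ c → Admissible c ∣ x₁ ∣ ∣ x₂ ∣ →
  Decreasing ε c (proj₁ (B^ ε · (x₁ , x₂ , x₃))) (proj₁ (proj₂ (B^ ε · (x₁ , x₂ , x₃))))
B^-decreasing Sign.+ x₁ x₂ x₃ c adm =
  subst₂ (Decreasing Sign.+ c) (sym (row₁ x₁ x₂ x₃)) (sym (row₂ x₁ x₂ x₃)) (B-decreasing x₁ x₂ c adm)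
  where
  row₁ : ∀ x₁ x₂ x₃ → + 3 * x₁ + + 4 * x₂ + + 0 * x₃ ≡ + 3 * x₁ + + 4 * x₂
  row₁ = solve-∀
  row₂ : ∀ x₁ x₂ x₃ → + 2 * x₁ + + 3 * x₂ + + 0 * x₃ ≡ + 2 * x₁ + + 3 * x₂
  row₂ = solve-∀
B^-decreasing Sign.- x₁ x₂ x₃ c adm =
  subst₂ (Decreasing Sign.- c) (sym (row₁ x₁ x₂ x₃)) (sym (row₂ x₁ x₂ x₃))
    (decreasing-flip (B₁ (- x₁) x₂) (B₂ (- x₁) x₂)
      (B-decreasing (- x₁) x₂ c (subst (λ s → Admissible c s ∣ x₂ ∣) (sym (ℤP.∣-i∣≡∣i∣ x₁)) adm)))
  where
  row₁ : ∀ x₁ x₂ x₃ → + 3 * x₁ + - (+ 4) * x₂ + + 0 * x₃ ≡ - (+ 3 * (- x₁) + + 4 * x₂)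
  row₁ = solve-∀
  row₂ : ∀ x₁ x₂ x₃ → - (+ 2) * x₁ + + 3 * x₂ + + 0 * x₃ ≡ + 2 * (- x₁) + + 3 * x₂
  row₂ = solve-∀

-- Lemma 5.3.  The output lies in Γ_a by invariance of the form, and is
-- decreasing because the input is admissible (∣x₁∣ < ∣x₂∣ and Γ-bound).
lemma5p3 : (ε : Sign) (a : ℤ) → ∣ a ∣ ≤ℕ 2 →
    (x₁ x₂ x₃ : ℤ) → Γ a (x₁ , x₂ , x₃) →
    ∣ x₁ ∣ <ℕ ∣ x₂ ∣ → ∣ x₂ ∣ <ℕ ∣ x₃ ∣ →
    (y₁ y₂ : ℤ) → B^ ε · (x₁ , x₂ , x₃) ≡ (y₁ , y₂ , x₃) →
    Γ a (y₁ , y₂ , x₃) × (∣ y₁ ∣ >ℕ ∣ y₂ ∣ × ∣ y₂ ∣ >ℕ ∣ x₃ ∣) × ⟦ ε ⟧ * y₁ * y₂ > + 0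
lemma5p3 ε a ∣a∣≤2 x₁ x₂ x₃ γ x₁<x₂ _ y₁ y₂ B^εx≡y =
  subst (Γ a) B^εx≡y (Γ-invariant ε a x₁ x₂ x₃ γ) ,
  subst₂ (Decreasing ε ∣ x₃ ∣) (cong proj₁ B^εx≡y) (cong (λ y → proj₁ (proj₂ y)) B^εx≡y)
    (B^-decreasing ε x₁ x₂ x₃ ∣ x₃ ∣ admissible)
  where
  admissible : Admissible (∣ x₃ ∣) (∣ x₁ ∣) (∣ x₂ ∣)
  admissible = x₁<x₂ , Γ-bound a x₁ x₂ x₃ ∣a∣≤2 γ
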